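{- For every graph $G$, $2\text{ - }cpw(G) \leq 2\,tpw(G)-1$. In particular, there is an absolute constant $\gamma$ such that for every graph $G$ with at least one edge, $2\text{ - }cpw(G) \leq 2\gamma\,\Delta(G)\, tw(G)$.
   Context: All graphs are finite and simple. $tw(G)$ and $pw(G)$ denote treewidth and pathwidth; $\Delta(G)$ is the maximum degree of $G$. For an integer $d\ge 1$, the clique preserving $d$-pathwidth $d\text{ - }cpw(G)$ is the smallest $k$ such that there are subgraphs $G_1,\dots,G_d$ of $G$, each of pathwidth at most $k$, with $G=G_1\cup\dots\cup G_d$ and such that every complete subgraph of $G$ is a subgraph of some $G_i$. A tree-partition decomposition of $G$ is a pair $(T,\mathbf{B})$ where $T$ is a forest and $\mathbf{B}=\{B(t): t\in V(T)\}$ is a family of bags forming a partition of $V(G)$, such that for distinct nodes $t_1,t_2$ of $T$, the bags $B(t_1)$ and $B(t_2)$ are adjacent in $G$ (some edge of $G$ joins them) if and only if $t_1,t_2$ are adjacent in $T$. Its width is the largest size of a bag, and the tree-partition width $tpw(G)$ is the smallest width of a tree-partition decomposition of $G$. -}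

module Defs where

open import Data.Nat using (ℕ; zero; suc; _≤_; _<_; _⊔_)
open import Data.Bool using (Bool; true; false)
open import Data.Fin using (Fin; toℕ)
open import Data.Fin.Subset using (Subset; _∈_; _⊆_; ∣_∣)
open import Data.Vec using (tabulate)
open import Data.List using (foldr; map; allFin)
open import Data.Maybe using (Maybe; just; nothing)
open import Data.Product using (Σ; ∃; _×_; _,_)
open import Data.Sum using (_⊎_)
open import Relation.Nullary using (¬_; does)
open import Relation.Binary.PropositionalEquality using (_≡_; _≢_)
import Data.Fin as F

record Graph : Set where
  field
    n      : ℕ
    adj    : Fin n → Fin n → Bool
    sym    : ∀ u v → adj u v ≡ true → adj v u ≡ true
    irrefl : ∀ v → adj v v ≡ false
open Graph public

Adj : (G : Graph) → Fin (n G) → Fin (n G) → Set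
Adj G u v = adj G u v ≡ true

HasEdge : Graph → Set
HasEdge G = Σ (Fin (n G)) λ u → Σ (Fin (n G)) λ v → Adj G u v

degree : (G : Graph) → Fin (n G) → ℕ
degree G v = ∣ tabulate (adj G v) ∣

Δ : Graph → ℕ
Δ G = foldr _⊔_ 0 (map (degree G) (allFin (n G)))

record Subgraph (G : Graph) : Set where
  field
    S      : Subset (n G)
    E      : Fin (n G) → Fin (n G) → Bool
    E-sym  : ∀ u v → E u v ≡ true → E v u ≡ true
    E-adj  : ∀ u v → E u v ≡ true → Adj G u v
    E-in   : ∀ u v → E u v ≡ true → (u ∈ S) × (v ∈ S)
open Subgraph public

-- Path decomposition of a subgraph H whose bags all have size ≤ b.
-- (pw(H) ≤ k  iff  such a decomposition exists with b = k + 1.)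
record PathDecomp {G : Graph} (H : Subgraph G) (b : ℕ) : Set where
  field
    len        : ℕ
    bag        : Fin len → Subset (n G)
    bag-sub    : ∀ i → bag i ⊆ S H
    vert-cov   : ∀ v → v ∈ S H → ∃ λ i → v ∈ bag i
    edge-cov   : ∀ u v → E H u v ≡ true → ∃ λ i → (u ∈ bag i) × (v ∈ bag i)
    contiguous : ∀ i j k v → toℕ i ≤ toℕ j → toℕ j ≤ toℕ k →
                 v ∈ bag i → v ∈ bag k → v ∈ bag j
    bag-size   : ∀ i → ∣ bag i ∣ ≤ b

IsClique : (G : Graph) → Subset (n G) → Set
IsClique G C = ∀ u v → u ∈ C → v ∈ C → u ≢ v → Adj G u v

CliqueIn : {G : Graph} → Subset (n G) → Subgraph G → Set
CliqueIn C H = (C ⊆ S H) ×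
  (∀ u v → u ∈ C → v ∈ C → u ≢ v → E H u v ≡ true)

-- "d-cpw(G) ≤ b - 1" (bags of size ≤ b, i.e. pathwidth ≤ b - 1):
-- subgraphs G_1..G_d covering G, each of pathwidth ≤ b - 1, such that every
-- complete subgraph of G is a subgraph of some G_i.
CPWBags : ℕ → Graph → ℕ → Set
CPWBags d G b = Σ (Fin d → Subgraph G) λ H →
    (∀ v → ∃ λ i → v ∈ S (H i))
  × (∀ u v → Adj G u v → ∃ λ i → E (H i) u v ≡ true)
  × (∀ C → IsClique G C → ∃ λ i → CliqueIn C (H i))
  × (∀ i → PathDecomp (H i) b)

-- Forests and trees on node set Fin m, given by a parent function in which
-- every parent has a smaller index (every forest admits such a labelling).

record Forest (m : ℕ) : Set where
  field
    parent    : Fin m → Maybe (Fin m)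
    parent-lt : ∀ i j → parent i ≡ just j → toℕ j < toℕ i
open Forest public

TAdj : ∀ {m} → Forest m → Fin m → Fin m → Set
TAdj T s t = (parent T s ≡ just t) ⊎ (parent T t ≡ just s)

record Tree (m : ℕ) : Set where
  field
    forest   : Forest (suc m)
    one-root : ∀ i → parent forest i ≡ nothing → i ≡ F.zero
open Tree public

data WalkIn {m} (T : Forest m) (P : Fin m → Set) : Fin m → Fin m → Set where
  here : ∀ {s} → P s → WalkIn T P s s
  step : ∀ {s t u} → P s → TAdj T s t → WalkIn T P t u → WalkIn T P s u

record TreeDecomp (G : Graph) (w : ℕ) : Set where
  field
    m         : ℕ
    tree      : Tree m
    bag       : Fin (suc m) → Subset (n G)
    vert-cov  : ∀ v → ∃ λ t → v ∈ bag t
    edge-cov  : ∀ u v → Adj G u v → ∃ λ t → (u ∈ bag t) × (v ∈ bag t)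
    connected : ∀ v s t → v ∈ bag s → v ∈ bag t →
                WalkIn (forest tree) (λ r → v ∈ bag r) s t
    bag-size  : ∀ t → ∣ bag t ∣ ≤ suc w

TW≤ : Graph → ℕ → Set
TW≤ G w = TreeDecomp G w

record TreePartition (G : Graph) (w : ℕ) : Set where
  field
    m        : ℕ
    T        : Forest m
    part     : Fin (n G) → Fin m
    nonempty : ∀ t → ∃ λ v → part v ≡ t
    adj-iff₁ : ∀ s t → s ≢ t →
               (∃ λ u → ∃ λ v → part u ≡ s × part v ≡ t × Adj G u v) → TAdj T s t
    adj-iff₂ : ∀ s t → s ≢ t → TAdj T s t →
               (∃ λ u → ∃ λ v → part u ≡ s × part v ≡ t × Adj G u v)
    width    : ∀ t → ∣ tabulate (λ v → does (part v F.≟ t)) ∣ ≤ w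

TPW≤ : Graph → ℕ → Set
TPW≤ G w = TreePartition G w

{-# OPTIONS --safe #-}

-- Properly 2-colour the forest of a tree-partition.  The two subgraphs consist of
-- the edges of G inside the stars whose centre has the first, resp. the second
-- colour; a clique meets at most two parts, hence lies in one star, and a star
-- of parts has a path decomposition whose bags are unions of two parts.  For
-- the second bound, a graph of treewidth t has tree-partition width O(Δ t): grow
-- the partition from a prescribed root set, moving down to its neighbourhood
-- when the set is small and splitting it by a balanced separator when it is large.
module Submission where

open import Defs
open import Data.Nat using (ℕ; suc; _*_)
open import Data.Product using (Σ; _×_)

open import Data.Bool using (Bool; true; false; not; _∧_; if_then_else_)
open import Data.Bool.Properties using (not-¬)
import Data.Bool.Properties as Bool
open import Data.Fin as Fin using (Fin; toℕ; combine; remQuot)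
import Data.Fin.Properties as Fin
open import Data.Fin.Induction using (>-wellFounded)
open import Data.Fin.Subset
  using (Subset; _∈_; _∉_; _⊆_; ∣_∣; _∪_; _∩_; ∁; ⁅_⁆; Empty; Nonempty; inside; outside)
  renaming (⊥ to ∅; ⊤ to full)
open import Data.Fin.Subset.Properties
open import Data.List using (foldr; map; allFin)
import Data.List as List
import Data.List.Membership.Propositional as List
open import Data.List.Membership.Propositional.Properties using (∈-allFin)
import Data.List.Relation.Unary.Any as Any
open import Data.Maybe using (Maybe; just; nothing; maybe′; fromMaybe)
open import Data.Maybe.Properties using (just-injective)
import Data.Maybe.Properties as Maybe
open import Data.Nat using (zero; _+_; _⊔_; _≤_; _<_; z≤n; s≤s; s≤s⁻¹)
open import Data.Nat.Properties
open import Data.Nat.Tactic.RingSolver using (solve-∀)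
open import Data.Product using (∃; _,_; proj₁; proj₂; map₂)
open import Data.Sum using (_⊎_; inj₁; inj₂; [_,_]′)
open import Data.Vec using (tabulate; []; _∷_; here; there)
open import Data.Vec.Properties using (lookup⇒[]=; []=⇒lookup; lookup∘tabulate)
open import Function using (_∘_)
open import Induction.WellFounded using (Acc; acc)
open import Relation.Binary.PropositionalEquality as ≡
  using (_≡_; _≢_; refl; trans; cong; subst)
open import Relation.Nullary using (¬_; Dec; yes; no; does; contradiction)
open import Relation.Nullary.Decidable
  using (_×-dec_; _⊎-dec_; ¬?; dec-true; dec-false; decidable-stable; map′; toSum)
open import Relation.Unary using (Decidable)

-- A star here is a centre with its children, the parent left out. Stars whose centres share a
-- colour are therefore disjoint, and each tree edge lies in exactly one star, that of its upper
-- end. Both bounds pass through `WeakTreePartition`, which allows empty parts and tree edges that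
-- no edge of `G` realises, so a partition obtained by glueing can be used as it comes. The obstacle
-- in the second bound is that a separator must enter the root sets of both sides, so root parts
-- swell as divisions are nested. No bound of the form `r ≤ C * s` absorbs this by itself; a bound
-- with a fixed amount subtracted does, provided every root set is budgeted at no less than that
-- amount. This is why a division has to leave a substantial share of the root set on each side. The
-- tree decomposition of `G` stays fixed throughout: every separator is one of `G`, cut down to the
-- current vertex set `U`.

select : ∀ {k} {P : Fin k → Set} → Decidable P → Subset k
select P? = tabulate (does ∘ P?)

∈-select⁺ : ∀ {k} {P : Fin k → Set} (P? : Decidable P) {x} → P x → x ∈ select P?
∈-select⁺ P? {x} px =
  lookup⇒[]= x _ (trans (lookup∘tabulate (does ∘ P?) x) (dec-true (P? x) px))

∈-select⁻ : ∀ {k} {P : Fin k → Set} (P? : Decidable P) {x} → x ∈ select P? → P x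
∈-select⁻ P? {x} x∈ with P? x | trans (≡.sym (lookup∘tabulate (does ∘ P?) x)) ([]=⇒lookup x∈)
... | yes px | _ = px

∣p∪q∣≤∣p∣+∣q∣ : ∀ {k} (p q : Subset k) → ∣ p ∪ q ∣ ≤ ∣ p ∣ + ∣ q ∣
∣p∪q∣≤∣p∣+∣q∣ []            []            = z≤n
∣p∪q∣≤∣p∣+∣q∣ (outside ∷ p) (outside ∷ q) = ∣p∪q∣≤∣p∣+∣q∣ p q
∣p∪q∣≤∣p∣+∣q∣ (outside ∷ p) (inside ∷ q)  =
  ≤-trans (s≤s (∣p∪q∣≤∣p∣+∣q∣ p q)) (≤-reflexive (≡.sym (+-suc ∣ p ∣ ∣ q ∣)))
∣p∪q∣≤∣p∣+∣q∣ (inside ∷ p)  (outside ∷ q) = s≤s (∣p∪q∣≤∣p∣+∣q∣ p q)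
∣p∪q∣≤∣p∣+∣q∣ (inside ∷ p)  (inside ∷ q)  =
  s≤s (≤-trans (∣p∪q∣≤∣p∣+∣q∣ p q) (+-monoʳ-≤ ∣ p ∣ (n≤1+n ∣ q ∣)))

∣p∣≤∣q∣+∣r∣ : ∀ {k} {p q r : Subset k} → p ⊆ q ∪ r → ∣ p ∣ ≤ ∣ q ∣ + ∣ r ∣
∣p∣≤∣q∣+∣r∣ {q = q} {r} p⊆ = ≤-trans (p⊆q⇒∣p∣≤∣q∣ p⊆) (∣p∪q∣≤∣p∣+∣q∣ q r)

-- Two-colouring a forest and its stars

module Colouring {m} (T : Forest m) where

  -- The first argument bounds the length of the path to the root.
  colourWithin : ℕ → Fin m → Bool
  colourWithin zero    i = false
  colourWithin (suc k) i = maybe′ (not ∘ colourWithin k) false (parent T i)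

  -- Lets the colours of a node and its parent be compared although they are computed with different
  -- bounds.
  colourWithin-unique : ∀ k l i → toℕ i < k → toℕ i < l →
                        colourWithin k i ≡ colourWithin l i
  colourWithin-unique (suc k) (suc l) i i<k i<l with parent T i in eq
  ... | nothing = refl
  ... | just j  = cong not (colourWithin-unique k l j
        (<-≤-trans (parent-lt T i j eq) (s≤s⁻¹ i<k))
        (<-≤-trans (parent-lt T i j eq) (s≤s⁻¹ i<l)))

  colour : Fin m → Bool
  colour i = colourWithin (suc (toℕ i)) i

  colour-parent : ∀ {i j} → parent T i ≡ just j → colour i ≡ not (colour j)
  colour-parent {i} {j} eq rewrite eq =
    cong not (colourWithin-unique (toℕ i) (suc (toℕ j)) j (parent-lt T i j eq) ≤-refl)

  colour-proper : ∀ {s t} → TAdj T s t → colour s ≡ not (colour t)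
  colour-proper (inj₁ eq) = colour-parent eq
  colour-proper {s} {t} (inj₂ eq) =
    trans (≡.sym (Bool.not-involutive _)) (cong not (≡.sym (colour-parent eq)))

  -- Both neighbours of `r` have the colour opposite to that of `r`, while adjacent nodes differ in
  -- colour.
  no-triangle : ∀ {r s t} → TAdj T r s → TAdj T r t → ¬ TAdj T s t
  no-triangle rs rt st = not-¬
    (Bool.not-injective (trans (≡.sym (colour-proper rs)) (colour-proper rt)))
    (colour-proper st)

  choose : Bool → Fin m → Maybe (Fin m) → Fin m
  choose true  s _ = s
  choose false s x = fromMaybe s x

  choose-cases : ∀ b s x → choose b s x ≡ s ⊎ x ≡ just (choose b s x)
  choose-cases true  s _        = inj₁ refl
  choose-cases false s nothing  = inj₁ refl
  choose-cases false s (just _) = inj₂ refl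

  -- The centre of the star containing `s`, among the stars of colour `p`. A root of the other
  -- colour has no parent to belong to and forms a star of its own.
  owner : Bool → Fin m → Fin m
  owner p s = choose (does (colour s Bool.≟ p)) s (parent T s)

  owner-cases : ∀ p s → owner p s ≡ s ⊎ parent T s ≡ just (owner p s)
  owner-cases p s = choose-cases (does (colour s Bool.≟ p)) s (parent T s)

  owner-self : ∀ s → owner (colour s) s ≡ s
  owner-self s rewrite dec-true (colour s Bool.≟ colour s) refl = refl

  owner-child : ∀ {s t} → parent T s ≡ just t → owner (colour t) s ≡ t
  owner-child {s} {t} eq
    rewrite dec-false (colour s Bool.≟ colour t) (λ e → not-¬ e (colour-parent eq)) | eq = refl

  -- The owner of the child end of a tree edge is that end or its parent, the other end. So one end
  -- is the common centre and the other serves as the leaf `c`.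
  owner-hub : ∀ p {s s′} → s ≡ s′ ⊎ TAdj T s s′ → owner p s ≡ owner p s′ →
              ∃ λ c → (s ≡ c ⊎ s ≡ owner p s) × (s′ ≡ c ⊎ s′ ≡ owner p s)
  owner-hub p {s} (inj₁ refl) _ = s , inj₁ refl , inj₁ refl
  owner-hub p {s} {s′} (inj₂ (inj₁ s↑s′)) _ with owner-cases p s
  ... | inj₁ eq = s′ , inj₂ (≡.sym eq) , inj₁ refl
  ... | inj₂ eq = s , inj₁ refl , inj₂ (just-injective (trans (≡.sym s↑s′) eq))
  owner-hub p {s} {s′} (inj₂ (inj₂ s′↑s)) same with owner-cases p s′
  ... | inj₁ eq = s , inj₁ refl , inj₂ (trans (≡.sym eq) (≡.sym same))
  ... | inj₂ eq = s′ , inj₂ (trans (just-injective (trans (≡.sym s′↑s) eq)) (≡.sym same)) , inj₁ refl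

-- From a partition along a forest to two subgraphs of small pathwidth

record WeakTreePartition (G : Graph) (w : ℕ) : Set where
  field
    m        : ℕ
    T        : Forest m
    part     : Fin (n G) → Fin m
    adjacent : ∀ u v → Adj G u v → part u ≡ part v ⊎ TAdj T (part u) (part v)
    width    : ∀ t → ∣ select (λ v → part v Fin.≟ t) ∣ ≤ w

treePartition⇒weak : ∀ {G w} → TreePartition G w → WeakTreePartition G w
treePartition⇒weak {G} P = record
  { m = m ; T = T ; part = part ; adjacent = adjacent ; width = width }
  where
  open TreePartition P
  adjacent : ∀ u v → Adj G u v → part u ≡ part v ⊎ TAdj T (part u) (part v)
  adjacent u v uv with part u Fin.≟ part v
  ... | yes eq  = inj₁ eq
  ... | no  neq = inj₂ (adj-iff₁ (part u) (part v) neq (u , v , refl , refl , uv))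

quotient-mono : ∀ {a b} (i j : Fin (a * b)) → toℕ i ≤ toℕ j →
                        toℕ (proj₁ (remQuot {a} b i)) ≤ toℕ (proj₁ (remQuot {a} b j))
quotient-mono {a} {b} i j i≤j = ≮⇒≥ λ lt → <⇒≱
  (subst (λ z → suc (toℕ z) ≤ toℕ i) (Fin.combine-remQuot {a} b j)
    (subst (λ z → suc (toℕ (combine (proj₁ (remQuot {a} b j)) (proj₂ (remQuot {a} b j)))) ≤ toℕ z)
      (Fin.combine-remQuot {a} b i) (Fin.combine-monoˡ-< _ _ lt)))
  i≤j

module Stars {G w} (P : WeakTreePartition G w) where
  open WeakTreePartition P
  open Colouring T

  hub : Bool → Fin (n G) → Fin m
  hub p v = owner p (part v)

  edge : Bool → Fin (n G) → Fin (n G) → Bool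
  edge p u v = adj G u v ∧ does (hub p u Fin.≟ hub p v)

  edge⁺ : ∀ p {u v} → Adj G u v → hub p u ≡ hub p v → edge p u v ≡ true
  edge⁺ p {u} {v} uv eq rewrite uv = dec-true (hub p u Fin.≟ hub p v) eq

  edge⁻ : ∀ p {u v} → edge p u v ≡ true → Adj G u v × hub p u ≡ hub p v
  edge⁻ p {u} {v} e with adj G u v | hub p u Fin.≟ hub p v
  ... | true | yes eq = refl , eq

  stars : Bool → Subgraph G
  stars p = record
    { S     = full
    ; E     = edge p
    ; E-sym = λ u v e → edge⁺ p (sym G u v (proj₁ (edge⁻ p e))) (≡.sym (proj₂ (edge⁻ p e)))
    ; E-adj = λ u v e → proj₁ (edge⁻ p e)
    ; E-in  = λ _ _ _ → ∈⊤ , ∈⊤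
    }

  -- The bag of centre t and leaf c.  Bags are ordered lexicographically in (t , c):
  -- a centre occupies all bags of its star, which are consecutive, a leaf only one.
  InStarBag : Bool → Fin m × Fin m → Fin (n G) → Set
  InStarBag p (t , c) v = hub p v ≡ t × (part v ≡ c ⊎ part v ≡ t)

  inStarBag? : ∀ p tc → Decidable (InStarBag p tc)
  inStarBag? p (t , c) v =
    (hub p v Fin.≟ t) ×-dec ((part v Fin.≟ c) ⊎-dec (part v Fin.≟ t))

  starBag : Bool → Fin (m * m) → Subset (n G)
  starBag p i = select (inStarBag? p (remQuot m i))

  ∈-starBag⁺ : ∀ p t c {v} → InStarBag p (t , c) v → v ∈ starBag p (combine t c)
  ∈-starBag⁺ p t c {v} v∈ = ∈-select⁺ (inStarBag? p _)
    (subst (λ tc → InStarBag p tc v) (≡.sym (Fin.remQuot-combine t c)) v∈)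

  starBag-edge : ∀ p {u v} → part u ≡ part v ⊎ TAdj T (part u) (part v) →
                 hub p u ≡ hub p v → ∃ λ i → u ∈ starBag p i × v ∈ starBag p i
  starBag-edge p {u} near same with owner-hub p near same
  ... | c , uc , vc = combine (hub p u) c
    , ∈-starBag⁺ p _ c (refl , uc) , ∈-starBag⁺ p _ c (≡.sym same , vc)

  starBag-contiguous : ∀ p i j k v → toℕ i ≤ toℕ j → toℕ j ≤ toℕ k →
                       v ∈ starBag p i → v ∈ starBag p k → v ∈ starBag p j
  starBag-contiguous p i j k v i≤j j≤k v∈i v∈k
    with ∈-select⁻ (inStarBag? p _) v∈i | ∈-select⁻ (inStarBag? p _) v∈k
  -- The hub of `v` is the first coordinate of both `i` and `k`; monotonicity of the quotient
  -- squeezes that of `j` between them.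
  ... | hᵢ , at-i | hₖ , at-k with Fin.toℕ-injective (≤-antisym
          (subst (λ t → toℕ t ≤ toℕ (proj₁ (remQuot {m} m j))) (≡.sym hᵢ)
            (quotient-mono {m} i j i≤j))
          (subst (λ t → toℕ (proj₁ (remQuot {m} m j)) ≤ toℕ t) (≡.sym hₖ)
            (quotient-mono {m} j k j≤k)))
  ... | hⱼ with at-i | at-k
  ...   | inj₂ e | _      = ∈-select⁺ (inStarBag? p _) (hⱼ , inj₂ (trans e (trans (≡.sym hᵢ) hⱼ)))
  ...   | inj₁ _ | inj₂ e = ∈-select⁺ (inStarBag? p _) (hⱼ , inj₂ (trans e (trans (≡.sym hₖ) hⱼ)))
  -- As a leaf, `v` determines both coordinates of its bag, so `i` and `k`, and with them `j`,
  -- coincide.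
  ...   | inj₁ e | inj₁ f = subst (λ l → v ∈ starBag p l) i≡j v∈i
    where
    i≡k : i ≡ k
    i≡k = trans (≡.sym (Fin.combine-remQuot {m} m i))
      (trans (≡.cong₂ combine (trans (≡.sym hᵢ) hₖ) (trans (≡.sym e) f))
             (Fin.combine-remQuot {m} m k))
    i≡j : i ≡ j
    i≡j = Fin.toℕ-injective (≤-antisym i≤j (subst (λ l → toℕ j ≤ toℕ l) (≡.sym i≡k) j≤k))

  starBag-size : ∀ p i → ∣ starBag p i ∣ ≤ 2 * w
  starBag-size p i = begin
    ∣ starBag p i ∣                        ≤⟨ ∣p∣≤∣q∣+∣r∣ bag⊆ ⟩
    ∣ select (λ v → part v Fin.≟ c) ∣ + ∣ select (λ v → part v Fin.≟ t) ∣
                                           ≤⟨ +-mono-≤ (width c) (width t) ⟩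
    w + w                                  ≡⟨ cong (w +_) (≡.sym (+-identityʳ w)) ⟩
    2 * w                                  ∎
    where
    open ≤-Reasoning
    t = proj₁ (remQuot {m} m i)
    c = proj₂ (remQuot {m} m i)
    bag⊆ : starBag p i ⊆ select (λ v → part v Fin.≟ c) ∪ select (λ v → part v Fin.≟ t)
    bag⊆ v∈ with proj₂ (∈-select⁻ (inStarBag? p _) v∈)
    ... | inj₁ e = x∈p∪q⁺ (inj₁ (∈-select⁺ (λ v → part v Fin.≟ c) e))
    ... | inj₂ e = x∈p∪q⁺ (inj₂ (∈-select⁺ (λ v → part v Fin.≟ t) e))

  starDecomp : ∀ p → PathDecomp (stars p) (2 * w)
  starDecomp p = record
    { len        = m * m
    ; bag        = starBag p
    ; bag-sub    = λ _ _ → ∈⊤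
    -- A vertex is covered as a degenerate edge from `v` to itself.
    ; vert-cov   = λ v _ → map₂ proj₁ (starBag-edge p {v} {v} (inj₁ refl) refl)
    ; edge-cov   = λ u v e →
        starBag-edge p (adjacent u v (proj₁ (edge⁻ p e))) (proj₂ (edge⁻ p e))
    ; contiguous = starBag-contiguous p
    ; bag-size   = starBag-size p
    }

  module _ {C : Subset (n G)} (clique : IsClique G C) where

    parts-near : ∀ {u v} → u ∈ C → v ∈ C → part u ≡ part v ⊎ TAdj T (part u) (part v)
    parts-near {u} {v} u∈ v∈ with u Fin.≟ v
    ... | yes u≡v = inj₁ (cong part u≡v)
    ... | no  u≢v = adjacent u v (clique u v u∈ v∈ u≢v)

    hub-constant⇒clique : ∀ p {t} → (∀ {v} → v ∈ C → hub p v ≡ t) → CliqueIn C (stars p)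
    hub-constant⇒clique p h = (λ _ → ∈⊤) , λ u v u∈ v∈ u≢v →
      edge⁺ p (clique u v u∈ v∈ u≢v) (trans (h u∈) (≡.sym (h v∈)))

    -- A member `x` in a third part would close a triangle in the forest. Hence every member lies in
    -- the centre `part v` or in its child `part u`.
    clique-in-star : ∀ {u v} → u ∈ C → v ∈ C → parent T (part u) ≡ just (part v) →
                     ∀ {x} → x ∈ C → hub (colour (part v)) x ≡ part v
    clique-in-star {u} {v} u∈ v∈ u↑v {x} x∈
      with parts-near x∈ u∈ | parts-near x∈ v∈
    ... | inj₁ xu | _       rewrite xu = owner-child u↑v
    ... | inj₂ _  | inj₁ xv rewrite xv = owner-self (part v)
    ... | inj₂ xu | inj₂ xv = contradiction (inj₁ u↑v) (no-triangle xu xv)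

    clique-covered : ∃ λ p → CliqueIn C (stars p)
    clique-covered with nonempty? C
    ... | no ¬C = true , (λ _ → ∈⊤) , λ u _ u∈ → contradiction (u , u∈) ¬C
    ... | yes (u , u∈)
      with Fin.any? (λ v → (v ∈? C) ×-dec ¬? (part u Fin.≟ part v))
    -- A clique within one part lies inside a star of either colour; `true` is an arbitrary choice.
    ...   | no one-part = true , hub-constant⇒clique true {owner true (part u)} λ {v} v∈ →
              cong (owner true) (≡.sym (decidable-stable (part u Fin.≟ part v)
                λ neq → one-part (v , v∈ , neq)))
    ...   | yes (v , v∈ , neq) with parts-near u∈ v∈
    ...     | inj₁ eq         = contradiction eq neq
    ...     | inj₂ (inj₁ u↑v) = _ , hub-constant⇒clique _ (clique-in-star u∈ v∈ u↑v)
    ...     | inj₂ (inj₂ v↑u) = _ , hub-constant⇒clique _ (clique-in-star v∈ u∈ v↑u)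

  edge-covered : ∀ {u v} → Adj G u v → ∃ λ p → edge p u v ≡ true
  edge-covered {u} {v} uv with adjacent u v uv
  ... | inj₁ eq         = true , edge⁺ true uv (cong (owner true) eq)
  ... | inj₂ (inj₁ u↑v) = colour (part v) ,
          edge⁺ _ uv (trans (owner-child u↑v) (≡.sym (owner-self (part v))))
  ... | inj₂ (inj₂ v↑u) = colour (part u) ,
          edge⁺ _ uv (trans (owner-self (part u)) (≡.sym (owner-child v↑u)))

  side : Fin 2 → Bool
  side Fin.zero    = true
  side (Fin.suc _) = false

  index : ∀ {Q : Bool → Set} → ∃ Q → ∃ (Q ∘ side)
  index (true  , q) = Fin.zero , q
  index (false , q) = Fin.suc Fin.zero , q

weak⇒CPW : ∀ {G w} → WeakTreePartition G w → CPWBags 2 G (2 * w)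
weak⇒CPW P = stars ∘ side
  , (λ _ → Fin.zero , ∈⊤)
  , (λ _ _ uv → index (edge-covered uv))
  , (λ _ clique → index (clique-covered clique))
  , λ i → starDecomp (side i)
  where open Stars P

-- Balanced separators from a tree decomposition

crossing : ∀ (f : ℕ → ℕ) θ → f 0 ≤ θ + θ → (∀ j → f (suc j) ≤ f j + θ) →
           ∀ k → θ ≤ f k → ∃ λ j → θ ≤ f j × f j ≤ θ + θ
crossing f θ start grow zero    θ≤ = 0 , θ≤ , start
crossing f θ start grow (suc k) θ≤ with θ ≤? f k
... | yes θ≤fk = crossing f θ start grow k θ≤fk
-- The value was still below `θ` one step earlier, and a single increment cannot leap over the
-- window from `θ` to `θ + θ`.
... | no  θ≰fk = suc k , θ≤ , ≤-trans (grow k) (+-monoˡ-≤ θ (<⇒≤ (≰⇒> θ≰fk)))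

data Descendant {m} (T : Forest m) (t : Fin m) : Fin m → Set where
  self  : Descendant T t t
  child : ∀ {r q} → parent T r ≡ just q → Descendant T t q → Descendant T t r

descendant? : ∀ {m} (T : Forest m) t → Decidable (Descendant T t)
descendant? T t r = go (suc (toℕ r)) r ≤-refl
  where
  go : ∀ k r → toℕ r < k → Dec (Descendant T t r)
  go (suc k) r r<k with r Fin.≟ t | parent T r in eq
  ... | yes refl | _       = yes self
  ... | no r≢t   | nothing = no λ
        { self → r≢t refl
        ; (child eq′ _) → contradiction (trans (≡.sym eq) eq′) λ () }
  ... | no r≢t   | just q  = map′ (child eq) from (go k q (<-≤-trans (parent-lt T r q eq) (s≤s⁻¹ r<k)))
    where
    from : Descendant T t r → Descendant T t q
    from self = contradiction refl r≢t
    from (child eq′ d) = subst (Descendant T t) (just-injective (trans (≡.sym eq′) eq)) d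

-- `Descendant` is built up at its lower end; this recovers the first step below `t`, the child
-- subtree that contains `r`.
descendant-split : ∀ {m} {T : Forest m} {t r} → Descendant T t r →
                   r ≡ t ⊎ ∃ λ c → parent T c ≡ just t × Descendant T c r
descendant-split self = inj₁ refl
descendant-split (child eq d) with descendant-split d
... | inj₁ refl           = inj₂ (_ , eq , self)
... | inj₂ (c , c↑t , d′) = inj₂ (c , c↑t , child eq d′)

descends-from-root : ∀ {m} (T : Tree m) r → Descendant (forest T) Fin.zero r
descends-from-root T r = go (suc (toℕ r)) r ≤-refl
  where
  go : ∀ k r → toℕ r < k → Descendant (forest T) Fin.zero r
  go (suc k) r r<k with parent (forest T) r in eq
  ... | nothing rewrite one-root T r eq = self
  ... | just q  = child eq (go k q (<-≤-trans (parent-lt (forest T) r q eq) (s≤s⁻¹ r<k)))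

walk-head : ∀ {m} {T : Forest m} {P : Fin m → Set} {s u} → WalkIn T P s u → P s
walk-head (here p)     = p
walk-head (step p _ _) = p

-- Only one side is recorded. The other is `∁ A ∪ X`, and the two overlap exactly in `X`.
record Separation (G : Graph) (S : Subset (n G)) (b θ : ℕ) : Set where
  field
    A X       : Subset (n G)
    X⊆A       : X ⊆ A
    separates : ∀ {u v} → u ∈ A → u ∉ X → Adj G u v → v ∈ A
    X-size    : ∣ X ∣ ≤ b
    A-large   : θ ≤ ∣ A ∩ S ∣
    A-small   : ∣ A ∩ S ∣ ≤ θ + θ

-- Take t lowest such that the bags below t hold at least θ elements of S, and
-- add the subtrees of the children of t to its bag one at a time: each adds
-- at most θ elements of S, so the count reaches θ without passing 2θ.
module Separator {G w} (D : TreeDecomp G w) (S : Subset (n G)) where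
  open TreeDecomp D
  private
    F = forest tree
    Node = Fin (suc m)

  below? : ∀ t → Decidable (λ v → ∃ λ r → Descendant F t r × v ∈ bag r)
  below? t v = Fin.any? λ r → descendant? F t r ×-dec (v ∈? bag r)

  below : Node → Subset (n G)
  below t = select (below? t)

  UnderFirst : Node → ℕ → Node → Set
  UnderFirst t j r = ∃ λ c → (parent F c ≡ just t × toℕ c < j) × Descendant F c r

  parent? : ∀ c t → Dec (parent F c ≡ just t)
  parent? c t = Maybe.≡-dec Fin._≟_ (parent F c) (just t)

  underFirst? : ∀ t j → Decidable (UnderFirst t j)
  underFirst? t j r = Fin.any? λ c →
    (parent? c t ×-dec (toℕ c <? j)) ×-dec descendant? F c r

  partial? : ∀ t j → Decidable (λ v → v ∈ bag t ⊎ ∃ λ r → UnderFirst t j r × v ∈ bag r)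
  partial? t j v = (v ∈? bag t) ⊎-dec Fin.any? λ r → underFirst? t j r ×-dec (v ∈? bag r)

  partial : Node → ℕ → Subset (n G)
  partial t j = select (partial? t j)

  underFirst-exit : ∀ {t j r r′} → UnderFirst t j r → TAdj F r r′ → r′ ≡ t ⊎ UnderFirst t j r′
  underFirst-exit (c , (c↑t , c<j) , self) (inj₁ eq) =
    inj₁ (just-injective (trans (≡.sym eq) c↑t))
  underFirst-exit (c , cs , child eq′ d) (inj₁ eq) =
    inj₂ (c , cs , subst (Descendant F c) (just-injective (trans (≡.sym eq′) eq)) d)
  underFirst-exit (c , cs , d) (inj₂ eq) = inj₂ (c , cs , child eq d)

  -- `UnderFirst t j` is a union of whole child subtrees, so `t` is the only node through which a
  -- walk can leave it.
  walk-exit : ∀ {t j} {P : Node → Set} {r s} → WalkIn F P r s →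
              UnderFirst t j r → ¬ UnderFirst t j s → P t
  walk-exit (here _) under ¬under = contradiction under ¬under
  walk-exit (step _ rr′ walk) under ¬under with underFirst-exit under rr′
  ... | inj₁ refl   = walk-head walk
  ... | inj₂ under′ = walk-exit walk under′ ¬under

  partial-separates : ∀ t j {u v} → u ∈ partial t j → u ∉ bag t → Adj G u v → v ∈ partial t j
  partial-separates t j {u} {v} u∈ u∉ uv with ∈-select⁻ (partial? t j) u∈ | edge-cov u v uv
  ... | inj₁ u∈t             | _ = contradiction u∈t u∉
  ... | inj₂ (r , under , u∈r) | s , u∈s , v∈s with underFirst? t j s
  ...   | yes under-s = ∈-select⁺ (partial? t j) (inj₂ (s , under-s , v∈s))
  ...   | no ¬under-s = contradiction (walk-exit (connected u r s u∈r u∈s) under ¬under-s) u∉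

  load : Node → ℕ
  load t = ∣ below t ∩ S ∣

  lowest : ∀ θ → θ ≤ ∣ S ∣ → ∃ λ t → θ ≤ load t × (∀ c → parent F c ≡ just t → load c ≤ θ)
  -- All of `S` lies below the root, so the descent can start there; it ends because children have
  -- larger indices than their parents.
  lowest θ θ≤S = go Fin.zero (>-wellFounded Fin.zero)
    (≤-trans θ≤S (p⊆q⇒∣p∣≤∣q∣ λ {v} v∈ → x∈p∩q⁺ (∈-select⁺ (below? Fin.zero)
      (map₂ (descends-from-root tree _ ,_) (vert-cov v)) , v∈)))
    where
    go : ∀ t → Acc Fin._>_ t → θ ≤ load t →
         ∃ λ t → θ ≤ load t × (∀ c → parent F c ≡ just t → load c ≤ θ)
    go t (acc rec) θ≤t with Fin.any? (λ c → parent? c t ×-dec (θ ≤? load c))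
    ... | yes (c , c↑t , θ≤c) = go c (rec (parent-lt F c t c↑t)) θ≤c
    ... | no  none = t , θ≤t , λ c c↑t → ≰⇒≥ λ θ≤c → none (c , c↑t , θ≤c)

  partial-step : ∀ θ t → (∀ c → parent F c ≡ just t → load c ≤ θ) → ∀ j →
                 ∣ partial t (suc j) ∩ S ∣ ≤ ∣ partial t j ∩ S ∣ + θ
  partial-step θ t light j with Fin.any? (λ c → parent? c t ×-dec (toℕ c ≟ j))
  ... | yes (c , c↑t , refl) = ≤-trans (∣p∣≤∣q∣+∣r∣ split) (+-monoʳ-≤ _ (light c c↑t))
    where
    split : partial t (suc (toℕ c)) ∩ S ⊆ (partial t (toℕ c) ∩ S) ∪ (below c ∩ S)
    split v∈ with x∈p∩q⁻ _ S v∈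
    ... | v∈A , v∈S with ∈-select⁻ (partial? t (suc (toℕ c))) v∈A
    ...   | inj₁ v∈t = x∈p∪q⁺ (inj₁ (x∈p∩q⁺ (∈-select⁺ (partial? t (toℕ c)) (inj₁ v∈t) , v∈S)))
    ...   | inj₂ (r , (d , (d↑t , d<) , desc) , v∈r) with m≤n⇒m<n∨m≡n (s≤s⁻¹ d<)
    ...     | inj₁ d<c = x∈p∪q⁺ (inj₁ (x∈p∩q⁺ (∈-select⁺ (partial? t (toℕ c))
                (inj₂ (r , (d , (d↑t , d<c) , desc) , v∈r)) , v∈S)))
    ...     | inj₂ d≡c = x∈p∪q⁺ (inj₂ (x∈p∩q⁺ (∈-select⁺ (below? c)
                (r , subst (λ e → Descendant F e r) (Fin.toℕ-injective d≡c) desc , v∈r) , v∈S)))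
  ... | no none = ≤-trans (p⊆q⇒∣p∣≤∣q∣ stays) (m≤m+n _ θ)
    where
    stays : partial t (suc j) ∩ S ⊆ partial t j ∩ S
    stays v∈ with x∈p∩q⁻ _ S v∈
    ... | v∈A , v∈S with ∈-select⁻ (partial? t (suc j)) v∈A
    ...   | inj₁ v∈t = x∈p∩q⁺ (∈-select⁺ (partial? t j) (inj₁ v∈t) , v∈S)
    ...   | inj₂ (r , (d , (d↑t , d<) , desc) , v∈r) with m≤n⇒m<n∨m≡n (s≤s⁻¹ d<)
    ...     | inj₁ d<j = x∈p∩q⁺ (∈-select⁺ (partial? t j)
                (inj₂ (r , (d , (d↑t , d<j) , desc) , v∈r)) , v∈S)
    ...     | inj₂ d≡j = contradiction (d , d↑t , d≡j) none

  bag⊆partial : ∀ t j → bag t ⊆ partial t j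
  bag⊆partial t j v∈ = ∈-select⁺ (partial? t j) (inj₁ v∈)

  partial-zero⊆bag : ∀ t → partial t 0 ⊆ bag t
  partial-zero⊆bag t v∈ with ∈-select⁻ (partial? t 0) v∈
  ... | inj₁ v∈t = v∈t
  ... | inj₂ (_ , (_ , (_ , ()) , _) , _)

  below⊆partial : ∀ t → below t ⊆ partial t (suc m)
  below⊆partial t v∈ with ∈-select⁻ (below? t) v∈
  ... | r , desc , v∈r with descendant-split desc
  ...   | inj₁ refl             = bag⊆partial t (suc m) v∈r
  ...   | inj₂ (c , c↑t , desc′) = ∈-select⁺ (partial? t (suc m))
            (inj₂ (r , (c , (c↑t , Fin.toℕ<n c) , desc′) , v∈r))

  separation : ∀ {θ} → suc w ≤ θ → θ ≤ ∣ S ∣ → Separation G S (suc w) θ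
  separation {θ} b≤θ θ≤S with lowest θ θ≤S
  -- At `j = 0` only `bag t` counts, with at most `suc w ≤ θ` vertices; at `j = suc m` everything
  -- below `t` is included, which carries at least `θ`.
  ... | t , θ≤t , light with crossing (λ j → ∣ partial t j ∩ S ∣) θ
          (≤-trans (≤-trans (∣p∩q∣≤∣p∣ (partial t 0) S) (p⊆q⇒∣p∣≤∣q∣ (partial-zero⊆bag t)))
            (≤-trans (bag-size t) (≤-trans b≤θ (m≤m+n θ θ))))
          (partial-step θ t light) (suc m)
          (≤-trans θ≤t (p⊆q⇒∣p∣≤∣q∣ λ v∈ → x∈p∩q⁺
            (below⊆partial t (proj₁ (x∈p∩q⁻ _ S v∈)) , proj₂ (x∈p∩q⁻ _ S v∈))))
  ...   | j , large , small = record
    { A         = partial t j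
    ; X         = bag t
    ; X⊆A       = bag⊆partial t j
    ; separates = partial-separates t j
    ; X-size    = bag-size t
    ; A-large   = large
    ; A-small   = small
    }

-- Counting in subsets and neighbourhoods

∣q∩p∣+∣∁q∩p∣≡∣p∣ : ∀ {k} (q p : Subset k) → ∣ q ∩ p ∣ + ∣ ∁ q ∩ p ∣ ≡ ∣ p ∣
∣q∩p∣+∣∁q∩p∣≡∣p∣ []            []            = refl
∣q∩p∣+∣∁q∩p∣≡∣p∣ (outside ∷ q) (outside ∷ p) = ∣q∩p∣+∣∁q∩p∣≡∣p∣ q p
∣q∩p∣+∣∁q∩p∣≡∣p∣ (inside ∷ q)  (outside ∷ p) = ∣q∩p∣+∣∁q∩p∣≡∣p∣ q p
∣q∩p∣+∣∁q∩p∣≡∣p∣ (inside ∷ q)  (inside ∷ p)  = cong suc (∣q∩p∣+∣∁q∩p∣≡∣p∣ q p)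
∣q∩p∣+∣∁q∩p∣≡∣p∣ (outside ∷ q) (inside ∷ p)  =
  trans (+-suc ∣ q ∩ p ∣ ∣ ∁ q ∩ p ∣) (cong suc (∣q∩p∣+∣∁q∩p∣≡∣p∣ q p))

∣q∣<∣p∣⇒∃∈p∉q : ∀ {k} {p q : Subset k} → ∣ q ∣ < ∣ p ∣ → ∃ λ x → x ∈ p × x ∉ q
∣q∣<∣p∣⇒∃∈p∉q {p = p} {q} q<p with Fin.any? (λ x → (x ∈? p) ×-dec ¬? (x ∈? q))
... | yes found = found
... | no  none  = contradiction
  (p⊆q⇒∣p∣≤∣q∣ λ {x} x∈p → decidable-stable (x ∈? q) λ x∉q → none (x , x∈p , x∉q))
  (<⇒≱ q<p)

image-⋃ : ∀ {k l} → Subset k → (Fin k → Subset l) → Subset l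
image-⋃ []            f = ∅
image-⋃ (outside ∷ p) f = image-⋃ p (f ∘ Fin.suc)
image-⋃ (inside ∷ p)  f = f Fin.zero ∪ image-⋃ p (f ∘ Fin.suc)

∈-image-⋃ : ∀ {k l} {p : Subset k} {f : Fin k → Subset l} {x v} →
            x ∈ p → v ∈ f x → v ∈ image-⋃ p f
∈-image-⋃ {p = inside ∷ p}  here       v∈ = x∈p∪q⁺ (inj₁ v∈)
∈-image-⋃ {p = inside ∷ p}  (there x∈) v∈ = x∈p∪q⁺ (inj₂ (∈-image-⋃ x∈ v∈))
∈-image-⋃ {p = outside ∷ p} (there x∈) v∈ = ∈-image-⋃ x∈ v∈

∣image-⋃∣ : ∀ {k l d} (p : Subset k) {f : Fin k → Subset l} →
            (∀ x → ∣ f x ∣ ≤ d) → ∣ image-⋃ p f ∣ ≤ ∣ p ∣ * d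
∣image-⋃∣ {l = l} []   f≤ = ≤-reflexive (∣⊥∣≡0 l)
∣image-⋃∣ (outside ∷ p) f≤ = ∣image-⋃∣ p (f≤ ∘ Fin.suc)
∣image-⋃∣ (inside ∷ p) {f} f≤ = ≤-trans (∣p∪q∣≤∣p∣+∣q∣ (f Fin.zero) _)
  (+-mono-≤ (f≤ Fin.zero) (∣image-⋃∣ p (f≤ ∘ Fin.suc)))

neighbours : (G : Graph) → Fin (n G) → Subset (n G)
neighbours G v = tabulate (adj G v)

∈-neighbours : ∀ {G u v} → Adj G u v → v ∈ neighbours G u
∈-neighbours {G} {u} {v} uv = lookup⇒[]= v _ (trans (lookup∘tabulate (adj G u) v) uv)

degree≤Δ : ∀ G v → degree G v ≤ Δ G
degree≤Δ G v = go (allFin (n G)) (∈-allFin v)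
  where
  go : ∀ vs → v List.∈ vs → degree G v ≤ foldr _⊔_ 0 (map (degree G) vs)
  go (u List.∷ vs) (Any.here refl) = m≤m⊔n _ _
  go (u List.∷ vs) (Any.there v∈)  = ≤-trans (go vs v∈) (m≤n⊔m (degree G u) _)

-- Rooted partitions: adding a new root, glueing at the roots

Near : ∀ {m} → (Fin m → Fin (suc m)) → Fin (suc m) → Fin (suc m) → Set
Near par s t = s ≡ t ⊎ Parent s t ⊎ Parent t s
  where
  Parent : _ → _ → Set
  -- The tree is encoded by its edges: edge `i` joins `suc i` to `par i`. Zero is thus the only
  -- root, and grafting and glueing become index shifts.
  Parent s t = ∃ λ i → s ≡ Fin.suc i × t ≡ par i

Near-map : ∀ {l m} {par : Fin l → Fin (suc l)} {par′ : Fin m → Fin (suc m)}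
           (f : Fin (suc l) → Fin (suc m)) →
           (∀ i → ∃ λ i′ → f (Fin.suc i) ≡ Fin.suc i′ × f (par i) ≡ par′ i′) →
           ∀ {s t} → Near par s t → Near par′ (f s) (f t)
Near-map f h (inj₁ refl)                     = inj₁ refl
Near-map f h (inj₂ (inj₁ (i , refl , refl))) = inj₂ (inj₁ (h i))
Near-map f h (inj₂ (inj₂ (i , refl , refl))) = inj₂ (inj₂ (h i))

Near-sym : ∀ {m} {par : Fin m → Fin (suc m)} {s t} → Near par s t → Near par t s
Near-sym (inj₁ eq)       = inj₁ (≡.sym eq)
Near-sym (inj₂ (inj₁ p)) = inj₂ (inj₂ p)
Near-sym (inj₂ (inj₂ p)) = inj₂ (inj₁ p)

-- A tree-partition of G[U] whose root part (node zero, of size ≤ r) contains R.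
-- The function part is total; its values outside U are meaningless.
record RootedPartition (G : Graph) (U R : Subset (n G)) (r w : ℕ) : Set where
  field
    m         : ℕ
    par       : Fin m → Fin (suc m)
    par-≤     : ∀ i → toℕ (par i) ≤ toℕ i
    part      : Fin (n G) → Fin (suc m)
    root      : ∀ {v} → v ∈ R → part v ≡ Fin.zero
    adjacent  : ∀ {u v} → u ∈ U → v ∈ U → Adj G u v → Near par (part u) (part v)
    root-size : ∣ U ∩ select (λ v → part v Fin.≟ Fin.zero) ∣ ≤ r
    width     : ∀ i → ∣ U ∩ select (λ v → part v Fin.≟ Fin.suc i) ∣ ≤ w

∈-part⁺ : ∀ {k m} {U : Subset k} (part : Fin k → Fin m) {t v} →
          v ∈ U → part v ≡ t → v ∈ U ∩ select (λ v → part v Fin.≟ t)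
∈-part⁺ part {t} v∈ eq = x∈p∩q⁺ (v∈ , ∈-select⁺ (λ v → part v Fin.≟ t) eq)

∈-part⁻ : ∀ {k m} {U : Subset k} (part : Fin k → Fin m) {t v} →
          v ∈ U ∩ select (λ v → part v Fin.≟ t) → v ∈ U × part v ≡ t
∈-part⁻ {U = U} part {t} v∈ = map₂ (∈-select⁻ (λ v → part v Fin.≟ t)) (x∈p∩q⁻ U _ v∈)

module _ {G : Graph} where

  emptyPartition : ∀ {U R w} → Empty U → RootedPartition G U R 0 w
  emptyPartition {U} ¬U = record
    { m         = 0
    ; par       = λ ()
    ; par-≤     = λ ()
    ; part      = λ _ → Fin.zero
    ; root      = λ _ → refl
    ; adjacent  = λ u∈ → contradiction (_ , u∈) ¬U
    ; root-size = ≤-trans (p⊆q⇒∣p∣≤∣q∣ {q = ∅} λ v∈ → contradiction (_ , proj₁ (x∈p∩q⁻ U _ v∈)) ¬U)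
                          (≤-reflexive (∣⊥∣≡0 (n G)))
    ; width     = λ ()
    }

  -- `R` becomes the new root part and the old root its only child. By `border`, the neighbours of
  -- `R` in the rest all lie in the old root part, so edges leaving `R` run along the single new
  -- tree edge.
  module Extend {U R U′ R′ r w} (P : RootedPartition G U′ R′ r w) (r≤w : r ≤ w)
    (rest   : ∀ {v} → v ∈ U → v ∉ R → v ∈ U′)
    (border : ∀ {u v} → u ∈ R → v ∈ U → v ∉ R → Adj G u v → v ∈ R′) where

    private module P = RootedPartition P

    part : Fin (n G) → Fin (suc (suc P.m))
    part v = if does (v ∈? R) then Fin.zero else Fin.suc (P.part v)

    part-in : ∀ {v} → v ∈ R → part v ≡ Fin.zero
    part-in {v} v∈ rewrite dec-true (v ∈? R) v∈ = refl

    part-out : ∀ {v} → v ∉ R → part v ≡ Fin.suc (P.part v)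
    part-out {v} v∉ rewrite dec-false (v ∈? R) v∉ = refl

    par : Fin (suc P.m) → Fin (suc (suc P.m))
    par Fin.zero    = Fin.zero
    par (Fin.suc i) = Fin.suc (P.par i)

    par-≤ : ∀ i → toℕ (par i) ≤ toℕ i
    par-≤ Fin.zero    = z≤n
    par-≤ (Fin.suc i) = s≤s (P.par-≤ i)

    border-near : ∀ {u v} → u ∈ R → v ∈ U → v ∉ R → Adj G u v → Near par (part u) (part v)
    border-near u∈ v∈ v∉ uv = inj₂ (inj₂
      (Fin.zero , trans (part-out v∉) (cong Fin.suc (P.root (border u∈ v∈ v∉ uv))) , part-in u∈))

    adjacent : ∀ {u v} → u ∈ U → v ∈ U → Adj G u v → Near par (part u) (part v)
    adjacent {u} {v} u∈ v∈ uv with toSum (u ∈? R) | toSum (v ∈? R)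
    ... | inj₁ u∈R | inj₁ v∈R = inj₁ (trans (part-in u∈R) (≡.sym (part-in v∈R)))
    ... | inj₁ u∈R | inj₂ v∉R = border-near u∈R v∈ v∉R uv
    ... | inj₂ u∉R | inj₁ v∈R = Near-sym (border-near v∈R u∈ u∉R (sym G u v uv))
    ... | inj₂ u∉R | inj₂ v∉R = ≡.subst₂ (Near par) (≡.sym (part-out u∉R)) (≡.sym (part-out v∉R))
      (Near-map Fin.suc (λ i → Fin.suc i , refl , refl)
        (P.adjacent (rest u∈ u∉R) (rest v∈ v∉R) uv))

    root⊆R : U ∩ select (λ v → part v Fin.≟ Fin.zero) ⊆ R
    root⊆R {v} v∈ with toSum (v ∈? R)
    ... | inj₁ v∈R = v∈R
    ... | inj₂ v∉R with trans (≡.sym (part-out v∉R)) (proj₂ (∈-part⁻ part v∈))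
    ...   | ()

    child⊆ : ∀ t → U ∩ select (λ v → part v Fin.≟ Fin.suc t) ⊆
                   U′ ∩ select (λ v → P.part v Fin.≟ t)
    child⊆ t {v} v∈ with toSum (v ∈? R) | ∈-part⁻ part v∈
    ... | inj₁ v∈R | _ , eq with trans (≡.sym (part-in v∈R)) eq
    ...   | ()
    child⊆ t {v} v∈ | inj₂ v∉R | v∈U , eq =
      ∈-part⁺ P.part (rest v∈U v∉R) (Fin.suc-injective (trans (≡.sym (part-out v∉R)) eq))

    width : ∀ t → ∣ U ∩ select (λ v → part v Fin.≟ Fin.suc t) ∣ ≤ w
    width Fin.zero    = ≤-trans (p⊆q⇒∣p∣≤∣q∣ (child⊆ Fin.zero)) (≤-trans P.root-size r≤w)
    width (Fin.suc i) = ≤-trans (p⊆q⇒∣p∣≤∣q∣ (child⊆ (Fin.suc i))) (P.width i)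

    extend : RootedPartition G U R ∣ R ∣ w
    extend = record
      { m = suc P.m ; par = par ; par-≤ = par-≤ ; part = part ; root = part-in
      ; adjacent = adjacent ; root-size = p⊆q⇒∣p∣≤∣q∣ root⊆R ; width = width }

  weakenRoot : ∀ {U R R′ r w} → R′ ⊆ R → RootedPartition G U R r w → RootedPartition G U R′ r w
  weakenRoot R′⊆R P = record
    { m = m ; par = par ; par-≤ = par-≤ ; part = part ; root = root ∘ R′⊆R
    ; adjacent = adjacent ; root-size = root-size ; width = width }
    where open RootedPartition P

  -- Gluing along the roots: node suc i of the first tree becomes suc (i ↑ˡ l),
  -- node suc j of the second becomes suc (k ↑ʳ j).
  module Merge {U R U₁ R₁ r₁ U₂ R₂ r₂ w A}
    (P : RootedPartition G U₁ R₁ r₁ w) (Q : RootedPartition G U₂ R₂ r₂ w)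
    (in₁     : ∀ {v} → v ∈ U → v ∈ A → v ∈ U₁)
    (in₂     : ∀ {v} → v ∈ U → v ∉ A → v ∈ U₂)
    (shared  : ∀ {v} → v ∈ U → v ∈ A → v ∈ U₂ → v ∈ R₁ × v ∈ R₂)
    (cross   : ∀ {u v} → u ∈ U → v ∈ U → u ∈ A → v ∉ A → Adj G u v → u ∈ U₂)
    (R⊆₁     : ∀ {v} → v ∈ R → v ∈ A → v ∈ R₁)
    (R⊆₂     : ∀ {v} → v ∈ R → v ∉ A → v ∈ R₂) where

    private
      module P = RootedPartition P
      module Q = RootedPartition Q
      k = P.m
      l = Q.m

    left : Fin (suc k) → Fin (suc (k + l))
    left = Fin._↑ˡ l

    right : Fin (suc l) → Fin (suc (k + l))
    right Fin.zero    = Fin.zero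
    right (Fin.suc j) = Fin.suc (k Fin.↑ʳ j)

    par : Fin (k + l) → Fin (suc (k + l))
    par i = [ left ∘ P.par , right ∘ Q.par ]′ (Fin.splitAt k i)

    toℕ-right : ∀ {j} (i : Fin l) → toℕ j ≤ toℕ i → toℕ (right j) ≤ k + toℕ i
    toℕ-right {Fin.zero}  i _   = z≤n
    toℕ-right {Fin.suc j} i j≤i = ≤-trans (≤-reflexive
      (trans (cong suc (Fin.toℕ-↑ʳ k j)) (≡.sym (+-suc k (toℕ j))))) (+-monoʳ-≤ k j≤i)

    par-≤ : ∀ i → toℕ (par i) ≤ toℕ i
    par-≤ i with Fin.splitAt k i in eq
    ... | inj₁ j = ≡.subst₂ _≤_ (≡.sym (Fin.toℕ-↑ˡ (P.par j) l))
            (trans (≡.sym (Fin.toℕ-↑ˡ j l)) (cong toℕ (Fin.splitAt⁻¹-↑ˡ eq))) (P.par-≤ j)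
    ... | inj₂ j = ≤-trans (toℕ-right j (Q.par-≤ j)) (≤-reflexive
            (trans (≡.sym (Fin.toℕ-↑ʳ k j)) (cong toℕ (Fin.splitAt⁻¹-↑ʳ {k} eq))))

    left-near : ∀ {s t} → Near P.par s t → Near par (left s) (left t)
    left-near = Near-map left λ i → i Fin.↑ˡ l , refl ,
      ≡.sym (cong [ left ∘ P.par , right ∘ Q.par ]′ (Fin.splitAt-↑ˡ k i l))

    right-near : ∀ {s t} → Near Q.par s t → Near par (right s) (right t)
    right-near = Near-map right λ i → k Fin.↑ʳ i , refl ,
      ≡.sym (cong [ left ∘ P.par , right ∘ Q.par ]′ (Fin.splitAt-↑ʳ k l i))

    part : Fin (n G) → Fin (suc (k + l))
    part v = if does (v ∈? A) then left (P.part v) else right (Q.part v)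

    part-left : ∀ {v} → v ∈ A → part v ≡ left (P.part v)
    part-left {v} v∈ rewrite dec-true (v ∈? A) v∈ = refl

    part-∉ : ∀ {v} → v ∉ A → part v ≡ right (Q.part v)
    part-∉ {v} v∉ rewrite dec-false (v ∈? A) v∉ = refl

    -- On the overlap of the two sides both partitions choose the root, and the roots are
    -- identified; so `Q` may be consulted on all of `U₂` although `part` prefers `P` on `A`.
    part-right : ∀ {v} → v ∈ U → v ∈ U₂ → part v ≡ right (Q.part v)
    part-right {v} v∈ v∈₂ with toSum (v ∈? A)
    ... | inj₂ v∉A = part-∉ v∉A
    ... | inj₁ v∈A = trans (part-left v∈A)
      (trans (cong left (P.root (proj₁ (shared v∈ v∈A v∈₂))))
             (cong right (≡.sym (Q.root (proj₂ (shared v∈ v∈A v∈₂))))))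

    adjacent-right : ∀ {u v} → u ∈ U → v ∈ U → u ∈ U₂ → v ∈ U₂ → Adj G u v →
                     Near par (part u) (part v)
    adjacent-right u∈ v∈ u∈₂ v∈₂ uv =
      ≡.subst₂ (Near par) (≡.sym (part-right u∈ u∈₂)) (≡.sym (part-right v∈ v∈₂))
        (right-near (Q.adjacent u∈₂ v∈₂ uv))

    adjacent : ∀ {u v} → u ∈ U → v ∈ U → Adj G u v → Near par (part u) (part v)
    adjacent {u} {v} u∈ v∈ uv with toSum (u ∈? A) | toSum (v ∈? A)
    ... | inj₁ u∈A | inj₁ v∈A = ≡.subst₂ (Near par) (≡.sym (part-left u∈A)) (≡.sym (part-left v∈A))
      (left-near (P.adjacent (in₁ u∈ u∈A) (in₁ v∈ v∈A) uv))
    -- An edge leaving `A` starts in the overlap, so it is an edge within `U₂`, accounted for by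
    -- `Q`.
    ... | inj₁ u∈A | inj₂ v∉A = adjacent-right u∈ v∈ (cross u∈ v∈ u∈A v∉A uv) (in₂ v∈ v∉A) uv
    ... | inj₂ u∉A | inj₁ v∈A =
      adjacent-right u∈ v∈ (in₂ u∈ u∉A) (cross v∈ u∈ v∈A u∉A (sym G u v uv)) uv
    ... | inj₂ u∉A | inj₂ v∉A = adjacent-right u∈ v∈ (in₂ u∈ u∉A) (in₂ v∈ v∉A) uv

    root : ∀ {v} → v ∈ R → part v ≡ Fin.zero
    root {v} v∈ with toSum (v ∈? A)
    ... | inj₁ v∈A = trans (part-left v∈A) (cong left (P.root (R⊆₁ v∈ v∈A)))
    ... | inj₂ v∉A = trans (part-∉ v∉A) (cong right (Q.root (R⊆₂ v∈ v∉A)))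

    left-injective : ∀ {s t} → left s ≡ left t → s ≡ t
    left-injective = Fin.↑ˡ-injective l _ _

    right-injective : ∀ {s t} → right s ≡ right t → s ≡ t
    right-injective {Fin.zero}  {Fin.zero}  _  = refl
    right-injective {Fin.suc s} {Fin.suc t} eq =
      cong Fin.suc (Fin.↑ʳ-injective k s t (Fin.suc-injective eq))

    left≢right : ∀ s j → left s ≢ right (Fin.suc j)
    left≢right (Fin.suc i) j eq with trans (≡.sym (Fin.splitAt-↑ˡ k i l))
      (trans (cong (Fin.splitAt k) (Fin.suc-injective eq)) (Fin.splitAt-↑ʳ k l j))
    ... | ()

    right≢left : ∀ s i → right s ≢ left (Fin.suc i)
    right≢left (Fin.suc j) i eq = left≢right (Fin.suc i) j (≡.sym eq)

    root-size : ∣ U ∩ select (λ v → part v Fin.≟ Fin.zero) ∣ ≤ r₁ + r₂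
    root-size = ≤-trans (∣p∣≤∣q∣+∣r∣ split) (+-mono-≤ P.root-size Q.root-size)
      where
      split : U ∩ select (λ v → part v Fin.≟ Fin.zero) ⊆
              (U₁ ∩ select (λ v → P.part v Fin.≟ Fin.zero)) ∪
              (U₂ ∩ select (λ v → Q.part v Fin.≟ Fin.zero))
      split {v} v∈ with toSum (v ∈? A) | ∈-part⁻ part v∈
      ... | inj₁ v∈A | v∈U , eq = x∈p∪q⁺ (inj₁ (∈-part⁺ P.part (in₁ v∈U v∈A)
              (left-injective (trans (≡.sym (part-left v∈A)) eq))))
      ... | inj₂ v∉A | v∈U , eq = x∈p∪q⁺ (inj₂ (∈-part⁺ Q.part (in₂ v∈U v∉A)
              (right-injective (trans (≡.sym (part-∉ v∉A)) eq))))

    width-left : ∀ i → U ∩ select (λ v → part v Fin.≟ left (Fin.suc i)) ⊆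
                       U₁ ∩ select (λ v → P.part v Fin.≟ Fin.suc i)
    width-left i {v} v∈ with toSum (v ∈? A) | ∈-part⁻ part v∈
    ... | inj₁ v∈A | v∈U , eq = ∈-part⁺ P.part (in₁ v∈U v∈A)
            (left-injective (trans (≡.sym (part-left v∈A)) eq))
    ... | inj₂ v∉A | _   , eq = contradiction (trans (≡.sym (part-∉ v∉A)) eq) (right≢left _ i)

    width-right : ∀ j → U ∩ select (λ v → part v Fin.≟ right (Fin.suc j)) ⊆
                        U₂ ∩ select (λ v → Q.part v Fin.≟ Fin.suc j)
    width-right j {v} v∈ with toSum (v ∈? A) | ∈-part⁻ part v∈
    ... | inj₁ v∈A | _   , eq = contradiction (trans (≡.sym (part-left v∈A)) eq) (left≢right _ j)
    ... | inj₂ v∉A | v∈U , eq = ∈-part⁺ Q.part (in₂ v∈U v∉A)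
            (right-injective (trans (≡.sym (part-∉ v∉A)) eq))

    width : ∀ i → ∣ U ∩ select (λ v → part v Fin.≟ Fin.suc i) ∣ ≤ w
    width i with Fin.splitAt k i in eq
    ... | inj₁ j with refl ← Fin.splitAt⁻¹-↑ˡ {k} eq = ≤-trans (p⊆q⇒∣p∣≤∣q∣ (width-left j)) (P.width j)
    ... | inj₂ j with refl ← Fin.splitAt⁻¹-↑ʳ {k} eq = ≤-trans (p⊆q⇒∣p∣≤∣q∣ (width-right j)) (Q.width j)

    merge : RootedPartition G U R (r₁ + r₂) w
    merge = record
      { m = k + l ; par = par ; par-≤ = par-≤ ; part = part ; root = root
      ; adjacent = adjacent ; root-size = root-size ; width = width }

rooted⇒weak : ∀ {G R r w} → RootedPartition G full R r w → r ≤ w → WeakTreePartition G w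
rooted⇒weak {G} {w = w} P r≤w = record
  { m = suc m ; T = forest′ ; part = part
  ; adjacent = λ u v uv → near⇒tadj (adjacent ∈⊤ ∈⊤ uv)
  ; width = λ t → ≤-trans
      (p⊆q⇒∣p∣≤∣q∣ {p = select (λ v → part v Fin.≟ t)} λ v∈ → x∈p∩q⁺ (∈⊤ , v∈)) (width′ t) }
  where
  open RootedPartition P
  parent′ : Fin (suc m) → Maybe (Fin (suc m))
  parent′ Fin.zero    = nothing
  parent′ (Fin.suc i) = just (par i)
  forest′ : Forest (suc m)
  forest′ = record
    { parent = parent′ ; parent-lt = λ { (Fin.suc i) _ refl → s≤s (par-≤ i) } }
  near⇒tadj : ∀ {s t} → Near par s t → s ≡ t ⊎ TAdj forest′ s t
  near⇒tadj (inj₁ eq)                       = inj₁ eq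
  near⇒tadj (inj₂ (inj₁ (i , refl , refl))) = inj₂ (inj₁ refl)
  near⇒tadj (inj₂ (inj₂ (i , refl , refl))) = inj₂ (inj₂ refl)
  width′ : ∀ t → ∣ full ∩ select (λ v → part v Fin.≟ t) ∣ ≤ w
  width′ Fin.zero    = ≤-trans root-size r≤w
  width′ (Fin.suc i) = width i

-- The recursive construction and its size bounds

merge-bound : ∀ {r₁ r₂ a c s b θ} → θ ≡ 4 * b →
              r₁ + θ ≤ (a + b) + (a + b) → r₂ + θ ≤ (c + b) + (c + b) → a + c ≤ s →
              r₁ + r₂ + θ ≤ s + s
merge-bound {r₁} {r₂} {a} {c} {s} {b} refl h₁ h₂ a+c≤s = +-cancelʳ-≤ (4 * b) _ _ (begin
  r₁ + r₂ + 4 * b + 4 * b                 ≡⟨ regroup r₁ r₂ (4 * b) ⟩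
  (r₁ + 4 * b) + (r₂ + 4 * b)             ≤⟨ +-mono-≤ h₁ h₂ ⟩
  -- The separator contributes `b` to each of two doubled budgets, `4 * b` in all; the second copy
  -- of `θ` on the left cancels it exactly, which fixes `θ = 4 * b`.
  ((a + b) + (a + b)) + ((c + b) + (c + b)) ≡⟨ collect a b c ⟩
  ((a + c) + (a + c)) + 4 * b             ≤⟨ +-monoˡ-≤ (4 * b) (+-mono-≤ a+c≤s a+c≤s) ⟩
  (s + s) + 4 * b                         ∎)
  where
  open ≤-Reasoning
  regroup : ∀ x y z → x + y + z + z ≡ (x + z) + (y + z)
  regroup = solve-∀
  collect : ∀ x y z → ((x + y) + (x + y)) + ((z + y) + (z + y)) ≡ ((x + z) + (x + z)) + 4 * y
  collect = solve-∀

-- Root parts are built by two moves: a root set S of at most 12b vertices is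
-- split off as a part above the rest, whose new root set is N(S); a larger one
-- is divided by a separator and the two root parts are glued.  The invariant
-- r + 4b ≤ 2s between the root part and its prescribed set S survives glueing
-- because the 4b lost pays for putting the separator into both sides.
module Decompose {G w} (D : TreeDecomp G w) (1≤Δ : 1 ≤ Δ G)
                 (θ : ℕ) (θ≡4b : θ ≡ 4 * suc w) where

  -- `bound` is the most neighbours that a peeled part of `θ + θ + θ` vertices can have, hence a
  -- ceiling for all budgets.
  b bound : ℕ
  b     = suc w
  bound = (θ + θ + θ) * Δ G

  b≤θ : b ≤ θ
  b≤θ = ≤-trans (m≤m+n b _) (≤-reflexive (≡.sym θ≡4b))

  1≤θ : 1 ≤ θ
  1≤θ = ≤-trans (s≤s z≤n) b≤θ

  3θ≤bound : θ + θ + θ ≤ bound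
  3θ≤bound = ≤-trans (≤-reflexive (≡.sym (*-identityʳ _))) (*-monoʳ-≤ (θ + θ + θ) 1≤Δ)

  θ≤3θ : θ ≤ θ + θ + θ
  θ≤3θ = m≤n+m θ (θ + θ)

  -- The budget `s` stands in for the size of `S`: since it is kept at least `θ`, the inequality can
  -- be met even when `S` is small or empty.
  Result : Subset (n G) → Subset (n G) → ℕ → Set
  Result U S s = ∃ λ r → r + θ ≤ s + s × RootedPartition G U S r (bound + bound)

  Hypothesis : ℕ → Set
  Hypothesis k = ∀ {U S s} → ∣ U ∣ < k → S ⊆ U → ∣ S ∣ ≤ s → θ ≤ s → s ≤ bound → Result U S s

  peel : ∀ {U R s} → Hypothesis ∣ U ∣ → R ⊆ U → Nonempty R →
         ∣ R ∣ ≤ θ + θ + θ → ∣ R ∣ ≤ s → θ ≤ s → Result U R s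
  peel {U} {R} {s} rec R⊆U (x , x∈R) R≤3θ R≤s θ≤s
    -- The budget is reset to its ceiling: the root part found here becomes an ordinary part, for
    -- which `bound + bound` is allowed.
    with rec {U ∩ ∁ R} {image-⋃ R (neighbours G) ∩ (U ∩ ∁ R)} {bound}
           (p⊂q⇒∣p∣<∣q∣ (p∩q⊆p U (∁ R) , x , R⊆U x∈R ,
             λ x∈ → x∈p⇒x∉∁p x∈R (proj₂ (x∈p∩q⁻ U (∁ R) x∈))))
           (p∩q⊆q _ (U ∩ ∁ R))
           (≤-trans (∣p∩q∣≤∣p∣ (image-⋃ R (neighbours G)) _)
             (≤-trans (∣image-⋃∣ R (degree≤Δ G)) (*-monoˡ-≤ (Δ G) R≤3θ)))
           (≤-trans θ≤3θ 3θ≤bound) ≤-refl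
  ... | r , r+θ≤ , P = ∣ R ∣ , +-mono-≤ R≤s θ≤s ,
    Extend.extend {U = U} {R = R} P (≤-trans (m≤m+n r θ) r+θ≤) rest
      (λ u∈R v∈U v∉R uv → x∈p∩q⁺ (∈-image-⋃ u∈R (∈-neighbours {G} uv) , rest v∈U v∉R))
    where
    rest : ∀ {v} → v ∈ U → v ∉ R → v ∈ U ∩ ∁ R
    rest v∈U v∉R = x∈p∩q⁺ (v∈U , x∉p⇒x∈∁p v∉R)

  -- Of more than `3θ` elements of `S`, at most `2θ` lie in `A`, so at least `θ` remain outside and
  -- both new budgets reach `θ`. Neither exceeds the size of `S`: `a + b` is at most `3θ`, and
  -- `c + b` is at most `c + a` because `b ≤ θ ≤ a`.
  divide : ∀ {U S s} → Hypothesis ∣ U ∣ → S ⊆ U → ∣ S ∣ ≤ s → s ≤ bound →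
           θ + θ + θ < ∣ S ∣ → Separation G S b θ → Result U S s
  divide {U} {S} {s} rec S⊆U S≤s s≤bound 3θ<S sep = glue
    (rec {U₁} {S₁} {a + b} U₁<U S₁⊆U₁ S₁≤ (≤-trans A-large (m≤m+n a b))
      (≤-trans (+-mono-≤ A-small b≤θ) (≤-trans (<⇒≤ 3θ<S) (≤-trans S≤s s≤bound))))
    (rec {U₂} {S₂} {c + b} U₂<U S₂⊆U₂ S₂≤ (≤-trans θ≤c (m≤m+n c b))
      (≤-trans (+-monoʳ-≤ c (≤-trans b≤θ A-large)) (≤-trans (≤-reflexive (+-comm c a))
        (≤-trans (≤-reflexive a+c≡S) (≤-trans S≤s s≤bound)))))
    where
    open Separation sep
    a c : ℕ
    a = ∣ A ∩ S ∣
    c = ∣ ∁ A ∩ S ∣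
    U₁ U₂ S₁ S₂ : Subset (n G)
    U₁ = U ∩ A
    U₂ = U ∩ (∁ A ∪ X)
    S₁ = (A ∩ S) ∪ (U ∩ X)
    S₂ = (∁ A ∩ S) ∪ (U ∩ X)

    a+c≡S : a + c ≡ ∣ S ∣
    a+c≡S = ∣q∩p∣+∣∁q∩p∣≡∣p∣ A S

    θ≤c : θ ≤ c
    θ≤c = +-cancelˡ-≤ (θ + θ) θ c
      (≤-trans (<⇒≤ 3θ<S) (≤-trans (≤-reflexive (≡.sym a+c≡S)) (+-monoˡ-≤ c A-small)))

    X≤ : ∣ U ∩ X ∣ ≤ b
    X≤ = ≤-trans (∣p∩q∣≤∣q∣ U X) X-size
    S₁≤ : ∣ S₁ ∣ ≤ a + b
    S₁≤ = ≤-trans (∣p∪q∣≤∣p∣+∣q∣ (A ∩ S) (U ∩ X)) (+-monoʳ-≤ a X≤)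
    S₂≤ : ∣ S₂ ∣ ≤ c + b
    S₂≤ = ≤-trans (∣p∪q∣≤∣p∣+∣q∣ (∁ A ∩ S) (U ∩ X)) (+-monoʳ-≤ c X≤)

    S₁⊆U₁ : S₁ ⊆ U₁
    S₁⊆U₁ v∈ with x∈p∪q⁻ (A ∩ S) (U ∩ X) v∈
    ... | inj₁ v∈AS = let v∈A , v∈S = x∈p∩q⁻ A S v∈AS in x∈p∩q⁺ (S⊆U v∈S , v∈A)
    ... | inj₂ v∈UX = let v∈U , v∈X = x∈p∩q⁻ U X v∈UX in x∈p∩q⁺ (v∈U , X⊆A v∈X)

    S₂⊆U₂ : S₂ ⊆ U₂
    S₂⊆U₂ v∈ with x∈p∪q⁻ (∁ A ∩ S) (U ∩ X) v∈
    ... | inj₁ v∈AS = let v∈A , v∈S = x∈p∩q⁻ (∁ A) S v∈AS in x∈p∩q⁺ (S⊆U v∈S , x∈p∪q⁺ (inj₁ v∈A))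
    ... | inj₂ v∈UX = let v∈U , v∈X = x∈p∩q⁻ U X v∈UX in x∈p∩q⁺ (v∈U , x∈p∪q⁺ (inj₂ v∈X))

    -- Since `c` is positive, some vertex of `S` lies outside `A`.
    U₁<U : ∣ U₁ ∣ < ∣ U ∣
    U₁<U with ∣q∣<∣p∣⇒∃∈p∉q {p = ∁ A ∩ S} {∅}
                (≤-trans (≤-reflexive (cong suc (∣⊥∣≡0 (n G)))) (≤-trans 1≤θ θ≤c))
    ... | x , x∈ , _ = let x∉A , x∈S = x∈p∩q⁻ (∁ A) S x∈ in
      p⊂q⇒∣p∣<∣q∣ (p∩q⊆p U A , x , S⊆U x∈S ,
        λ x∈U₁ → x∈∁p⇒x∉p x∉A (proj₂ (x∈p∩q⁻ U A x∈U₁)))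

    -- `A ∩ S` has at least `4 * b` vertices and `X` at most `b`, so some vertex of `S` lies in `A`
    -- but not in `X`.
    U₂<U : ∣ U₂ ∣ < ∣ U ∣
    U₂<U with ∣q∣<∣p∣⇒∃∈p∉q {p = A ∩ S} {X}
                (≤-trans (s≤s X-size) (≤-trans b<θ A-large))
      where
      b<θ : suc b ≤ θ
      b<θ = ≤-trans (≤-trans (≤-reflexive (+-comm 1 b)) (+-monoʳ-≤ b (s≤s z≤n)))
                    (≤-reflexive (≡.sym θ≡4b))
    ... | x , x∈ , x∉X = let x∈A , x∈S = x∈p∩q⁻ A S x∈ in
      p⊂q⇒∣p∣<∣q∣ (p∩q⊆p U _ , x , S⊆U x∈S , λ x∈U₂ →
        outside-U₂ x∈A (x∈p∪q⁻ (∁ A) X (proj₂ (x∈p∩q⁻ U _ x∈U₂))))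
      where
      outside-U₂ : x ∈ A → ¬ (x ∈ ∁ A ⊎ x ∈ X)
      outside-U₂ x∈A (inj₁ x∈∁A) = x∈p⇒x∉∁p x∈A x∈∁A
      outside-U₂ _   (inj₂ x∈X)  = x∉X x∈X

    in-both : ∀ {v} → v ∈ U → v ∈ A → v ∈ U₂ → v ∈ S₁ × v ∈ S₂
    in-both v∈U v∈A v∈U₂ with x∈p∪q⁻ (∁ A) X (proj₂ (x∈p∩q⁻ U _ v∈U₂))
    ... | inj₁ v∈∁A = contradiction v∈∁A (x∈p⇒x∉∁p v∈A)
    ... | inj₂ v∈X  = x∈p∪q⁺ (inj₂ (x∈p∩q⁺ (v∈U , v∈X))) , x∈p∪q⁺ (inj₂ (x∈p∩q⁺ (v∈U , v∈X)))

    crosses-at-X : ∀ {u v} → u ∈ U → v ∈ U → u ∈ A → v ∉ A → Adj G u v → u ∈ U₂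
    crosses-at-X {u} u∈U _ u∈A v∉A uv = x∈p∩q⁺ (u∈U , x∈p∪q⁺ (inj₂
      (decidable-stable (u ∈? X) λ u∉X → v∉A (separates u∈A u∉X uv))))

    glue : Result U₁ S₁ (a + b) → Result U₂ S₂ (c + b) → Result U S s
    glue (r₁ , r₁≤ , P) (r₂ , r₂≤ , Q) = r₁ + r₂
      , merge-bound {r₁} {r₂} {a} {c} θ≡4b r₁≤ r₂≤ (≤-trans (≤-reflexive a+c≡S) S≤s)
      , Merge.merge {U = U} {R = S} {A = A} P Q
          (λ v∈U v∈A → x∈p∩q⁺ (v∈U , v∈A))
          (λ v∈U v∉A → x∈p∩q⁺ (v∈U , x∈p∪q⁺ (inj₁ (x∉p⇒x∈∁p v∉A))))
          in-both
          crosses-at-X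
          (λ v∈S v∈A → x∈p∪q⁺ (inj₁ (x∈p∩q⁺ (v∈A , v∈S))))
          (λ v∈S v∉A → x∈p∪q⁺ (inj₁ (x∈p∩q⁺ (x∉p⇒x∈∁p v∉A , v∈S))))

  decompose-step : ∀ {U S s} → Hypothesis ∣ U ∣ → S ⊆ U → ∣ S ∣ ≤ s → θ ≤ s → s ≤ bound →
                   Result U S s
  decompose-step {U} {S} {s} rec S⊆U S≤s θ≤s s≤bound
    with nonempty? U | nonempty? S | ∣ S ∣ ≤? θ + θ + θ
  ... | no ¬U         | _      | _        = 0 , ≤-trans θ≤s (m≤m+n s s) , emptyPartition ¬U
  ... | yes _         | yes S≠∅ | yes S≤3θ = peel rec S⊆U S≠∅ S≤3θ S≤s θ≤s
  ... | yes _         | yes _   | no S≰3θ  = divide rec S⊆U S≤s s≤bound (≰⇒> S≰3θ)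
    (Separator.separation D S b≤θ (≤-trans θ≤3θ (≰⇒≥ S≰3θ)))
  -- With nothing prescribed, an arbitrary vertex is peeled off so that `U` still shrinks.
  ... | yes (x , x∈U) | no S≡∅  | _        =
    map₂ (map₂ (weakenRoot λ v∈S → contradiction (_ , v∈S) S≡∅))
      (peel {R = ⁅ x ⁆} rec
        (λ v∈ → subst (_∈ U) (≡.sym (x∈⁅y⁆⇒x≡y x v∈)) x∈U)
        (x , x∈⁅x⁆ x)
        (≤-trans x≤θ θ≤3θ) (≤-trans x≤θ θ≤s) θ≤s)
    where
    x≤θ : ∣ ⁅ x ⁆ ∣ ≤ θ
    x≤θ = ≤-trans (≤-reflexive (∣⁅x⁆∣≡1 x)) 1≤θ

  decompose : ∀ k → Hypothesis k
  decompose (suc k) U<k = decompose-step (λ V<U → decompose k (<-≤-trans V<U (s≤s⁻¹ U<k)))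

  weakPartition : WeakTreePartition G (bound + bound)
  -- The construction starts with no prescribed vertex and the least admissible budget, `θ`.
  weakPartition with decompose (suc ∣ full {n G} ∣) {full} {∅} ≤-refl ⊆⊤
                       (≤-trans (≤-reflexive (∣⊥∣≡0 (n G))) z≤n) ≤-refl (≤-trans θ≤3θ 3θ≤bound)
  ... | r , r+θ≤ , P = rooted⇒weak P (≤-trans (m≤m+n r θ)
        (≤-trans r+θ≤ (+-mono-≤ θ≤bound θ≤bound)))
    where
    θ≤bound : θ ≤ bound
    θ≤bound = ≤-trans θ≤3θ 3θ≤bound

-- The constant in terms of maximum degree and treewidth

CPW-mono : ∀ {d G b b′} → b ≤ b′ → CPWBags d G b → CPWBags d G b′
CPW-mono b≤b′ (H , vs , es , cs , Ps) = H , vs , es , cs , λ i → let open PathDecomp (Ps i) in record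
  { len = len ; bag = bag ; bag-sub = bag-sub ; vert-cov = vert-cov ; edge-cov = edge-cov
  ; contiguous = contiguous ; bag-size = λ j → ≤-trans (bag-size j) b≤b′ }

edge⇒1≤Δ : ∀ G → HasEdge G → 1 ≤ Δ G
edge⇒1≤Δ G (u , v , uv) = ≤-trans
  (≤-trans (≤-reflexive (≡.sym (∣⁅x⁆∣≡1 v))) (p⊆q⇒∣p∣≤∣q∣ λ {x} x∈ →
    subst (_∈ neighbours G u) (≡.sym (x∈⁅y⁆⇒x≡y v x∈)) (∈-neighbours {G} uv)))
  (degree≤Δ G u)

edge⇒1≤tw : ∀ {G w} → HasEdge G → TreeDecomp G w → 1 ≤ w
edge⇒1≤tw {G} (u , v , uv) D = s≤s⁻¹ (≤-trans two (bag-size t))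
  where
  open TreeDecomp D
  t = proj₁ (edge-cov u v uv)
  u∈t = proj₁ (proj₂ (edge-cov u v uv))
  v∈t = proj₂ (proj₂ (edge-cov u v uv))
  v∉⁅u⁆ : v ∉ ⁅ u ⁆
  v∉⁅u⁆ v∈ with refl ← x∈⁅y⁆⇒x≡y u v∈ = contradiction (trans (≡.sym uv) (irrefl G u)) λ ()
  two : 2 ≤ ∣ bag t ∣
  two = subst (λ k → suc k ≤ ∣ bag t ∣) (∣⁅x⁆∣≡1 u) (p⊂q⇒∣p∣<∣q∣
    ((λ x∈ → subst (_∈ bag t) (≡.sym (x∈⁅y⁆⇒x≡y u x∈)) u∈t) , v , v∈t , v∉⁅u⁆))

-- `M` is `12 (w + 1) d`; it doubles once for the root parts and once for star bags made of two
-- parts, giving `48 (w + 1) d`. An edge forces `1 ≤ w`, so `w + 1 ≤ 2 w` turns this into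
-- `2 * 48 * d * w`.
constant-bound : ∀ {w} d → 1 ≤ w →
  let M = (4 * suc w + 4 * suc w + 4 * suc w) * d in 2 * (M + M) ≤ suc (2 * 48 * d * w)
constant-bound {w} d 1≤w = begin
  2 * (M + M)          ≡⟨ expand w d ⟩
  48 * d * (w + 1)     ≤⟨ *-monoʳ-≤ (48 * d) (+-monoʳ-≤ w 1≤w) ⟩
  48 * d * (w + w)     ≡⟨ collect w d ⟩
  2 * 48 * d * w       ≤⟨ n≤1+n _ ⟩
  suc (2 * 48 * d * w) ∎
  where
  open ≤-Reasoning
  M = (4 * suc w + 4 * suc w + 4 * suc w) * d
  expand : ∀ w d → let M = (4 * (1 + w) + 4 * (1 + w) + 4 * (1 + w)) * d in
           2 * (M + M) ≡ 48 * d * (w + 1)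
  expand = solve-∀
  collect : ∀ w d → 48 * d * (w + w) ≡ 2 * 48 * d * w
  collect = solve-∀

theorem2 : ((G : Graph) → (w : ℕ) → TPW≤ G w → CPWBags 2 G (2 * w))
    × Σ ℕ (λ γ → (G : Graph) → HasEdge G → (t : ℕ) → TW≤ G t →
    CPWBags 2 G (suc (2 * γ * Δ G * t)))
theorem2 = (λ G w P → weak⇒CPW (treePartition⇒weak P))
  , 48 , λ G hasEdge t D → CPW-mono (constant-bound (Δ G) (edge⇒1≤tw hasEdge D))
      (weak⇒CPW (Decompose.weakPartition D (edge⇒1≤Δ G hasEdge) _ refl))
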